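{- Let $\mathrm{a}_{n,k}^{\mathrm{pk}}(132,321)$ denote the number of permutations of $\{1,\dots,n\}$ that avoid both $132$ and $321$ and have exactly $k$ peaks. Then for all integers $n\ge1$ and $k\ge0$, $$\mathrm{a}_{n,k}^{\mathrm{pk}}(132,321)=\begin{cases}n,&k=0;\\ \binom{n-1}{2},&k=1;\\ 0,&\text{otherwise}.\end{cases}$$
   Context: $\mathcal{S}_n$ is the set of permutations $\pi=\pi_1\cdots\pi_n$ of $\{1,\dots,n\}$. For $\rho\in\mathcal{S}_m$, $\pi\in\mathcal{S}_n$ contains $\rho$ if there are indices $1\le i_1<\cdots<i_m\le n$ such that $\pi_{i_a}<\pi_{i_b}$ if and only if $\rho_a<\rho_b$; otherwise $\pi$ avoids $\rho$. The number of peaks is $\mathrm{pk}(\pi)=|\{i:\pi_i<\pi_{i+1}\text{ and }\pi_{i+1}>\pi_{i+2}\}|$, where $1\le i\le n-2$. Binomial coefficients $\binom{m}{j}$ with $j>m\ge 0$ are $0$. -}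

module Defs where

open import Data.Fin using (Fin; toℕ; _<_)
open import Data.Fin.Patterns using (0F; 1F; 2F)
open import Data.Fin.Permutation using (Permutation′; _⟨$⟩ʳ_; transpose; reverse; ↔⇒≡)
open import Data.Fin.Properties using (any?; _<?_)
open import Data.List using ([]; _∷_; length; filter; allFin; map)
open import Data.Nat using (ℕ; _+_; _∸_)
open import Data.Nat.Combinatorics using (_C_)
open import Data.Nat.Properties using (_≟_)
open import Data.Product using (Σ; ∃; ∃₂; _×_; proj₁)
open import Function using (_⇔_; Inverse)
open import Function.Properties.Inverse
  using () renaming (sym to inverse-sym; trans to inverse-trans)
open import Level using (0ℓ)
open import Relation.Binary using (Setoid)
import Relation.Binary.Construct.On as On
open import Relation.Binary.PropositionalEquality
  using (_≡_; refl; setoid; _→-setoid_)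
open import Relation.Nullary using (¬_; Dec)
open import Relation.Nullary.Decidable using (_×-dec_)

Contains : ∀ {m n} → Permutation′ m → Permutation′ n → Set
Contains {m} {n} ρ π =
  ∃ λ (ι : Fin m → Fin n) →
    (∀ a b → a < b → ι a < ι b) ×
    (∀ a b → (π ⟨$⟩ʳ ι a < π ⟨$⟩ʳ ι b) ⇔ (ρ ⟨$⟩ʳ a < ρ ⟨$⟩ʳ b))

Avoids : ∀ {m n} → Permutation′ m → Permutation′ n → Set
Avoids ρ π = ¬ Contains ρ π

-- The indices i + 1 and i + 2 are supplied as elements j and l of Fin n,
-- so that i is restricted to positions with two successors.
PeakAt : ∀ {n} → Permutation′ n → Fin n → Set
PeakAt π i =
  ∃₂ λ j l →
    toℕ j ≡ 1 + toℕ i ×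
    toℕ l ≡ 2 + toℕ i ×
    π ⟨$⟩ʳ i < π ⟨$⟩ʳ j ×
    π ⟨$⟩ʳ l < π ⟨$⟩ʳ j

peakAt? : ∀ {n} (π : Permutation′ n) (i : Fin n) → Dec (PeakAt π i)
peakAt? π i = any? λ j → any? λ l →
  (toℕ j ≟ 1 + toℕ i) ×-dec
  (toℕ l ≟ 2 + toℕ i) ×-dec
  ((π ⟨$⟩ʳ i) <? (π ⟨$⟩ʳ j)) ×-dec
  ((π ⟨$⟩ʳ l) <? (π ⟨$⟩ʳ j))

pk : ∀ {n} → Permutation′ n → ℕ
pk {n} π = length (filter (peakAt? π) (allFin n))

π132 π321 : Permutation′ 3
π132 = transpose 1F 2F
π321 = reverse

_ : map (π132 ⟨$⟩ʳ_) (allFin 3) ≡ 0F ∷ 2F ∷ 1F ∷ []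
_ = refl

_ : map (π321 ⟨$⟩ʳ_) (allFin 3) ≡ 2F ∷ 1F ∷ 0F ∷ []
_ = refl

_ : pk π132 ≡ 1
_ = refl

_ : pk π321 ≡ 0
_ = refl

Avoider : ℕ → ℕ → Set
Avoider n k = Σ (Permutation′ n) λ π → Avoids π132 π × Avoids π321 π × pk π ≡ k

-- Avoiders are identified when they take the same values: neither the inverse
-- packaged in a Permutation′ nor the avoidance proofs contribute to the count.
Avoiders : ℕ → ℕ → Setoid 0ℓ 0ℓ
Avoiders n k = On.setoid {B = Avoider n k} (Fin n →-setoid Fin n) λ σ → proj₁ σ ⟨$⟩ʳ_

HasCardinality : Setoid 0ℓ 0ℓ → ℕ → Set
HasCardinality S c = Inverse S (setoid (Fin c))

cardinality-unique : ∀ {S c d} → HasCardinality S c → HasCardinality S d → c ≡ d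
cardinality-unique p q = ↔⇒≡ (inverse-trans (inverse-sym p) q)

closedForm : ℕ → ℕ → ℕ
closedForm n 0 = n
closedForm n 1 = (n ∸ 1) C 2
closedForm n _ = 0

{-# OPTIONS --safe #-}

-- Let j and ℓ be the value at position 0 and the position of the value 0.
-- Avoiding 321 and 132 forces the entries before 0 to be j, j + 1, …, and every
-- later entry to be the least value not used so far.  Hence the avoiders are the
-- permutations that swap an initial block of length ℓ with the next block of
-- length j and fix everything else.  Their only possible descent is across the
-- boundary of the blocks, and it makes a peak exactly when ℓ ≥ 2 and j ≥ 1.  So
-- the avoiders without peaks are those with ℓ = 1 (the identity being j = 0), and
-- those with a peak are counted by the pairs with ℓ ≥ 2, j ≥ 1 and ℓ + j ≤ n.

module Submission where

open import Defs
open import Data.Empty using (⊥-elim)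
open import Data.Fin as Fin using (Fin; zero; suc; toℕ; fromℕ<; inject₁)
open import Data.Fin.Induction using (<-wellFounded)
open import Data.Fin.Patterns using (0F; 1F; 2F)
open import Data.Fin.Permutation
  using (Permutation′; _⟨$⟩ʳ_; _⟨$⟩ˡ_; permutation; inverseˡ; inverseʳ)
open import Data.Fin.Properties
  using (toℕ-injective; toℕ-fromℕ<; toℕ<n; toℕ-inject₁; +↔⊎)
open import Data.List using ([]; _∷_; length; allFin)
open import Data.List.Membership.Propositional using (_∈_)
open import Data.List.Membership.Propositional.Properties
  using (∈-filter⁺; ∈-filter⁻; ∈-allFin)
open import Data.List.Properties using (filter-none)
open import Data.List.Relation.Unary.All as All using ()
open import Data.List.Relation.Unary.AllPairs using (_∷_)
open import Data.List.Relation.Unary.Any using (here; there)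
open import Data.List.Relation.Unary.Unique.Propositional using (Unique)
open import Data.List.Relation.Unary.Unique.Propositional.Properties
  using (filter⁺; allFin⁺)
open import Data.Nat
open import Data.Nat.Combinatorics using (_C_; nC1≡n; nCk+nC[k+1]≡[n+1]C[k+1])
open import Data.Nat.Properties
open import Data.Product using (Σ; ∃; _×_; _,_; proj₁; proj₂)
open import Data.Sum using (_⊎_; inj₁; inj₂)
open import Data.Sum.Function.Propositional using (_⊎-↔_)
open import Function using (_∘_; _↔_; mk↔ₛ′; mk⇔; Bijection; Equivalence)
open import Function.Properties.Bijection using (Bijection⇒Inverse)
open import Function.Properties.Inverse
  using (↔-refl; ↔-sym; ↔-trans)
  renaming (sym to inverse-sym; trans to inverse-trans)
open import Induction.WellFounded using (Acc; acc)
open import Relation.Binary.Definitions using (Tri; tri<; tri≈; tri>)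
open import Relation.Binary.PropositionalEquality
  using (_≡_; _≢_; refl; sym; trans; cong; subst; subst₂; setoid)
open import Relation.Nullary using (¬_; yes; no; contradiction)

private variable
  m n j ℓ i i′ v v′ : ℕ

-- Block swaps as relations between positions and values.

-- The graph of the swap, from positions i to values v; stated with additions only,
-- it is visibly symmetric under exchanging j with ℓ and i with v.
data BlockSwap (j ℓ i v : ℕ) : Set where
  up   : i < ℓ → v ≡ j + i → BlockSwap j ℓ i v
  down : v < j → i ≡ ℓ + v → BlockSwap j ℓ i v
  stay : ℓ + j ≤ i → v ≡ i → BlockSwap j ℓ i v

-- Inverting the permutation exchanges the two block lengths, so `swap-injective` and the inverse in
-- `swapPerm` follow from facts about one direction.
swap-sym : BlockSwap j ℓ i v → BlockSwap ℓ j v i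
swap-sym (up p q)   = down p q
swap-sym (down p q) = up p q
swap-sym {j} {ℓ} {i} (stay p refl) = stay (subst (_≤ i) (+-comm ℓ j) p) refl

-- Values increase within each block and within the fixed tail, and the tail lies to the right of
-- and above both blocks. An inversion must therefore go from the first block to the second.
swap-descent : BlockSwap j ℓ i v → BlockSwap j ℓ i′ v′ → i < i′ → v′ < v →
               i < ℓ × v ≡ j + i × v′ < j × i′ ≡ ℓ + v′
swap-descent (up p q) (down p′ q′) _ _ = p , q , p′ , q′
swap-descent {j = j} (up _ refl) (up _ refl) i<i′ v′<v =
  contradiction (+-monoʳ-< j i<i′) (<-asym v′<v)
swap-descent {j} {ℓ} {i′ = i′} (up p refl) (stay p′ refl) _ v′<v =
  contradiction (<-≤-trans (+-monoʳ-< j p) (subst (_≤ i′) (+-comm ℓ j) p′)) (<-asym v′<v)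
swap-descent {ℓ = ℓ} (down _ refl) (up p′ _) i<i′ _ =
  contradiction (<-≤-trans (<-trans i<i′ p′) (m≤m+n ℓ _)) (<-irrefl refl)
swap-descent {ℓ = ℓ} (down _ refl) (down _ refl) i<i′ v′<v =
  contradiction (+-monoʳ-< ℓ v′<v) (<-asym i<i′)
swap-descent {j} {ℓ} (down p _) (stay p′ refl) _ v′<v =
  contradiction (<-≤-trans (<-trans v′<v p) (≤-trans (m≤n+m j ℓ) p′)) (<-irrefl refl)
swap-descent {j} {ℓ} (stay p refl) (up p′ _) i<i′ _ =
  contradiction (<-trans (<-≤-trans p′ (≤-trans (m≤m+n ℓ j) p)) i<i′) (<-irrefl refl)
swap-descent {ℓ = ℓ} (stay p refl) (down p′ refl) i<i′ _ =
  contradiction (<-≤-trans (<-trans i<i′ (+-monoʳ-< ℓ p′)) p) (<-irrefl refl)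
swap-descent (stay _ refl) (stay _ refl) i<i′ v′<v = contradiction v′<v (<-asym i<i′)

-- The constructors place `i` in disjoint ranges: below `ℓ`, from `ℓ` up to but excluding `ℓ + j`,
-- and from `ℓ + j` on.
swap-functional : BlockSwap j ℓ i v → BlockSwap j ℓ i v′ → v ≡ v′
swap-functional (up _ q) (up _ q′) = trans q (sym q′)
swap-functional {ℓ = ℓ} (up p _) (down _ refl) = contradiction p (m+n≮m ℓ _)
swap-functional {j} {ℓ} (up p _) (stay p′ _) =
  contradiction (<-≤-trans p (≤-trans (m≤m+n ℓ j) p′)) (<-irrefl refl)
swap-functional {ℓ = ℓ} (down _ refl) (up p′ _) = contradiction p′ (m+n≮m ℓ _)
swap-functional {ℓ = ℓ} (down _ q) (down _ q′) = +-cancelˡ-≡ ℓ _ _ (trans (sym q) q′)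
swap-functional {ℓ = ℓ} (down p refl) (stay p′ _) =
  contradiction (+-monoʳ-< ℓ p) (≤⇒≯ p′)
swap-functional {j} {ℓ} (stay p _) (up p′ _) =
  contradiction (<-≤-trans p′ (≤-trans (m≤m+n ℓ j) p)) (<-irrefl refl)
swap-functional {ℓ = ℓ} (stay p _) (down p′ refl) =
  contradiction (+-monoʳ-< ℓ p′) (≤⇒≯ p)
swap-functional (stay _ q) (stay _ q′) = trans q (sym q′)

swap-injective : BlockSwap j ℓ i v → BlockSwap j ℓ i′ v → i ≡ i′
swap-injective s s′ = swap-functional (swap-sym s) (swap-sym s′)

swap-total : ∀ j ℓ i → ∃ (BlockSwap j ℓ i)
swap-total j ℓ i with i <? ℓ | i <? ℓ + j
... | yes i<ℓ | _ = j + i , up i<ℓ refl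
... | no i≮ℓ | no i≮ℓ+j = i , stay (≮⇒≥ i≮ℓ+j) refl
... | no i≮ℓ | yes i<ℓ+j = i ∸ ℓ , down (+-cancelˡ-< ℓ _ _ (subst (_< ℓ + j) i≡ i<ℓ+j)) i≡
  where
  i≡ : i ≡ ℓ + (i ∸ ℓ)
  i≡ = sym (m+[n∸m]≡n (≮⇒≥ i≮ℓ))

swap-bounded : ℓ + j ≤ n → i < n → BlockSwap j ℓ i v → v < n
swap-bounded {ℓ} {j} {n} ℓ+j≤n _ (up p refl) =
  <-≤-trans (+-monoʳ-< j p) (subst (_≤ n) (+-comm ℓ j) ℓ+j≤n)
swap-bounded {ℓ} _ i<n (down _ refl) = ≤-<-trans (m≤n+m _ ℓ) i<n
swap-bounded _ i<n (stay _ refl) = i<n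

swap-trivial : BlockSwap 0 ℓ i v → v ≡ i
swap-trivial (up _ q) = q
swap-trivial (stay _ q) = q

-- Block swaps as permutations.

IsSwap : ℕ → ℕ → Permutation′ n → Set
IsSwap j ℓ π = ∀ i → BlockSwap j ℓ (toℕ i) (toℕ (π ⟨$⟩ʳ i))

isSwap-value : (π : Permutation′ n) → IsSwap j ℓ π → (i<n : i < n) → BlockSwap j ℓ i v →
               toℕ (π ⟨$⟩ʳ fromℕ< i<n) ≡ v
isSwap-value {j = j} {ℓ} {v = v} π isSwap i<n s = swap-functional (isSwap (fromℕ< i<n))
  (subst (λ x → BlockSwap j ℓ x v) (sym (toℕ-fromℕ< i<n)) s)

swapFin : ∀ j ℓ → ℓ + j ≤ n → Fin n → Fin n
swapFin j ℓ b i = fromℕ< (swap-bounded b (toℕ<n i) (proj₂ (swap-total j ℓ (toℕ i))))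

swapFin-spec : ∀ j ℓ (b : ℓ + j ≤ n) (i : Fin n) → BlockSwap j ℓ (toℕ i) (toℕ (swapFin j ℓ b i))
swapFin-spec j ℓ b i =
  subst (BlockSwap j ℓ _) (sym (toℕ-fromℕ< _)) (proj₂ (swap-total j ℓ (toℕ i)))

swapFin-inverse : ∀ j ℓ (b : ℓ + j ≤ n) (b′ : j + ℓ ≤ n) (i : Fin n) →
                  swapFin j ℓ b (swapFin ℓ j b′ i) ≡ i
swapFin-inverse j ℓ b b′ i = toℕ-injective
  (swap-functional (swapFin-spec j ℓ b (swapFin ℓ j b′ i)) (swap-sym (swapFin-spec ℓ j b′ i)))

swapPerm : ∀ j ℓ → ℓ + j ≤ n → Permutation′ n
swapPerm {n} j ℓ b = permutation (swapFin j ℓ b) (swapFin ℓ j b′)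
  (swapFin-inverse j ℓ b b′) (swapFin-inverse ℓ j b′ b)
  where
  b′ : j + ℓ ≤ n
  b′ = subst (_≤ n) (+-comm ℓ j) b

swapPerm-isSwap : ∀ j ℓ (b : ℓ + j ≤ n) → IsSwap j ℓ (swapPerm j ℓ b)
swapPerm-isSwap = swapFin-spec

-- Exhibiting occurrences of patterns.

module _ {n} (π : Permutation′ n) where

  ʳ-injective : ∀ {a b} → π ⟨$⟩ʳ a ≡ π ⟨$⟩ʳ b → a ≡ b
  ʳ-injective eq = trans (sym (inverseˡ π)) (trans (cong (π ⟨$⟩ˡ_) eq) (inverseˡ π))

  -- Indexing the second condition by the values of `ρ` makes both conditions monotonicity
  -- statements, so a pattern of length 3 needs only two comparisons for each. The reverse
  -- implication of the equivalence comes from trichotomy.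
  contains : (ρ : Permutation′ m) (ι : Fin m → Fin n) →
             (∀ a b → a Fin.< b → ι a Fin.< ι b) →
             (∀ u v → u Fin.< v → π ⟨$⟩ʳ ι (ρ ⟨$⟩ˡ u) Fin.< π ⟨$⟩ʳ ι (ρ ⟨$⟩ˡ v)) →
             Contains ρ π
  contains ρ ι mono monoᵛ = ι , mono , λ a b → mk⇔ (reflects a b) (preserves a b)
    where
    preserves : ∀ a b → ρ ⟨$⟩ʳ a Fin.< ρ ⟨$⟩ʳ b → π ⟨$⟩ʳ ι a Fin.< π ⟨$⟩ʳ ι b
    preserves a b lt = subst₂ (λ x y → π ⟨$⟩ʳ ι x Fin.< π ⟨$⟩ʳ ι y)
                         (inverseˡ ρ) (inverseˡ ρ) (monoᵛ _ _ lt)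
    reflects : ∀ a b → π ⟨$⟩ʳ ι a Fin.< π ⟨$⟩ʳ ι b → ρ ⟨$⟩ʳ a Fin.< ρ ⟨$⟩ʳ b
    reflects a b lt with <-cmp (toℕ (ρ ⟨$⟩ʳ a)) (toℕ (ρ ⟨$⟩ʳ b))
    ... | tri< ρa<ρb _ _ = ρa<ρb
    ... | tri≈ _ ρa≡ρb _ = contradiction lt (<-irrefl (cong (toℕ ∘ (π ⟨$⟩ʳ_) ∘ ι) a≡b))
      where
      a≡b : a ≡ b
      a≡b = trans (sym (inverseˡ ρ)) (trans (cong (ρ ⟨$⟩ˡ_) (toℕ-injective ρa≡ρb)) (inverseˡ ρ))
    ... | tri> _ _ ρb<ρa = contradiction (preserves b a ρb<ρa) (<-asym lt)

  mono₃ : (f : Fin 3 → Fin n) → f 0F Fin.< f 1F → f 1F Fin.< f 2F →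
          ∀ a b → a Fin.< b → f a Fin.< f b
  mono₃ f p q 0F 1F _ = p
  mono₃ f p q 0F 2F _ = <-trans p q
  mono₃ f p q 1F 2F _ = q
  mono₃ f p q 1F 1F (s≤s ())
  mono₃ f p q 2F 1F (s≤s ())
  mono₃ f p q 2F 2F (s≤s (s≤s ()))

  triple : Fin n → Fin n → Fin n → Fin 3 → Fin n
  triple a b c 0F = a
  triple a b c 1F = b
  triple a b c 2F = c

  contains-132 : ∀ {a b c} → a Fin.< b → b Fin.< c →
                 π ⟨$⟩ʳ a Fin.< π ⟨$⟩ʳ c → π ⟨$⟩ʳ c Fin.< π ⟨$⟩ʳ b → Contains π132 π
  contains-132 {a} {b} {c} p q r s =
    contains π132 (triple a b c) (mono₃ _ p q)
      (mono₃ (λ u → π ⟨$⟩ʳ triple a b c (π132 ⟨$⟩ˡ u)) r s)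

  contains-321 : ∀ {a b c} → a Fin.< b → b Fin.< c →
                 π ⟨$⟩ʳ c Fin.< π ⟨$⟩ʳ b → π ⟨$⟩ʳ b Fin.< π ⟨$⟩ʳ a → Contains π321 π
  contains-321 {a} {b} {c} p q r s =
    contains π321 (triple a b c) (mono₃ _ p q)
      (mono₃ (λ u → π ⟨$⟩ʳ triple a b c (π321 ⟨$⟩ˡ u)) r s)

  -- Patterns and peaks of a block swap.

  module _ (isSwap : IsSwap j ℓ π) where

    -- The descent from 3 to 2 ends below `j`, while the 1 stands further left in the first block
    -- and so has value at least `j`.
    swap-avoids-132 : Avoids π132 π
    swap-avoids-132 (ι , mono , iff)
      with swap-descent (isSwap (ι 1F)) (isSwap (ι 2F)) (mono 1F 2F (s≤s (s≤s z≤n)))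
             (Equivalence.from (iff 2F 1F) (s≤s (s≤s z≤n)))
    ... | b<ℓ , _ , πc<j , _ = contradiction
      (<-trans (<-≤-trans πc<j (m≤m+n j _))
        (subst (_< toℕ (π ⟨$⟩ʳ ι 2F))
          (swap-functional (isSwap (ι 0F)) (up (<-trans (mono 0F 1F (s≤s z≤n)) b<ℓ) refl))
          (Equivalence.from (iff 0F 2F) (s≤s z≤n))))
      (<-irrefl refl)

    -- The middle entry ends one descent and starts another, so it would lie in both blocks.
    swap-avoids-321 : Avoids π321 π
    swap-avoids-321 (ι , mono , iff)
      with swap-descent (isSwap (ι 0F)) (isSwap (ι 1F)) (mono 0F 1F (s≤s z≤n))
             (Equivalence.from (iff 1F 0F) (s≤s (s≤s z≤n)))
         | swap-descent (isSwap (ι 1F)) (isSwap (ι 2F)) (mono 1F 2F (s≤s (s≤s z≤n)))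
             (Equivalence.from (iff 2F 1F) (s≤s z≤n))
    ... | _ , _ , _ , b≡ | b<ℓ , _ = contradiction (subst (_< ℓ) b≡ b<ℓ) (m+n≮m ℓ _)

    -- The descent of the peak crosses the block boundary, so `i + 1 < ℓ ≤ i + 2`.
    peak-position : ∀ {i} → PeakAt π i → 2 + toℕ i ≡ ℓ
    peak-position {i} (a , b , a≡ , b≡ , _ , πb<πa)
      with swap-descent (isSwap a) (isSwap b) (subst₂ _<_ (sym a≡) (sym b≡) ≤-refl) πb<πa
    ... | a<ℓ , _ , _ , b≡′ = ≤-antisym (subst (_< ℓ) a≡ a<ℓ)
                                (subst (ℓ ≤_) (trans (sym b≡′) b≡) (m≤m+n ℓ _))

    pk≡0 : ℓ ≤ 1 → pk π ≡ 0
    pk≡0 ℓ≤1 = cong length (filter-none (peakAt? π) (All.universal noPeak (allFin n)))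
      where
      noPeak : ∀ i → ¬ PeakAt π i
      noPeak i peak = contradiction (subst (_≤ 1) (sym (peak-position peak)) ℓ≤1) (λ { (s≤s ()) })

length-singleton : ∀ {A : Set} {x : A} {xs} → Unique xs → x ∈ xs →
                   (∀ {y} → y ∈ xs → y ≡ x) → length xs ≡ 1
length-singleton {xs = _ ∷ []} _ _ _ = refl
length-singleton {xs = _ ∷ _ ∷ _} ((y≢z All.∷ _) ∷ _) _ only =
  contradiction (trans (only (here refl)) (sym (only (there (here refl))))) y≢z

-- The peak consists of the last two entries of the first block, at positions `m` and `m + 1`,
-- followed by the value 0 at position `ℓ = m + 2`.
swap-peak : (π : Permutation′ n) → IsSwap (suc j) (2 + m) π → (m<n : m < n) →
            2 + m < n → PeakAt π (fromℕ< m<n)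
swap-peak {j = j} {m = m} π isSwap m<n 2+m<n =
  fromℕ< 1+m<n , fromℕ< 2+m<n ,
  trans (toℕ-fromℕ< 1+m<n) (cong suc (sym (toℕ-fromℕ< m<n))) ,
  trans (toℕ-fromℕ< 2+m<n) (cong (2 +_) (sym (toℕ-fromℕ< m<n))) ,
  subst₂ _<_ (sym (value m<n (up (s≤s (n≤1+n m)) refl))) (sym πj)
    (+-monoʳ-< (suc j) (n<1+n m)) ,
  subst₂ _<_ (sym (value 2+m<n (down z<s (sym (+-identityʳ _))))) (sym πj) z<s
  where
  1+m<n = <-trans (n<1+n (suc m)) 2+m<n
  value : (i<n : i < _) → BlockSwap (suc j) (2 + m) i v → toℕ (π ⟨$⟩ʳ fromℕ< i<n) ≡ v
  value = isSwap-value π isSwap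
  πj = value 1+m<n (up ≤-refl refl)

pk≡1 : (π : Permutation′ n) → IsSwap (suc j) (2 + m) π → (2 + m) + suc j ≤ n → pk π ≡ 1
pk≡1 {n} {j} {m} π isSwap b = length-singleton (filter⁺ (peakAt? π) (allFin⁺ n))
  (∈-filter⁺ (peakAt? π) (∈-allFin _) (swap-peak π isSwap m<n 2+m<n))
  λ y∈ → toℕ-injective (trans (suc-injective (suc-injective
    (peak-position π isSwap (proj₂ (∈-filter⁻ (peakAt? π) {xs = allFin n} y∈)))))
    (sym (toℕ-fromℕ< m<n)))
  where
  2+m<n = <-≤-trans (m<m+n (2 + m) z<s) b
  m<n = <-trans (n<1+n m) (<-trans (n<1+n (suc m)) 2+m<n)

-- Every avoider is a block swap.

module _ {N} (π : Permutation′ (suc N)) (av132 : Avoids π132 π) (av321 : Avoids π321 π) where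

  private
    zeroPosition : Fin (suc N)
    zeroPosition = π ⟨$⟩ˡ zero
    j₀ ℓ₀ : ℕ
    j₀ = toℕ (π ⟨$⟩ʳ zero)
    ℓ₀ = toℕ zeroPosition

    SwapAt : Fin (suc N) → Set
    SwapAt i = BlockSwap j₀ ℓ₀ (toℕ i) (toℕ (π ⟨$⟩ʳ i))

    value-at-zeroPosition : toℕ (π ⟨$⟩ʳ zeroPosition) ≡ 0
    value-at-zeroPosition = cong toℕ (inverseʳ π)

    position : v < suc N → ∃ λ q → toℕ (π ⟨$⟩ʳ q) ≡ v
    position v<n = π ⟨$⟩ˡ fromℕ< v<n , trans (cong toℕ (inverseʳ π)) (toℕ-fromℕ< v<n)

    positive : ∀ {q} → q ≢ zeroPosition → 0 < toℕ (π ⟨$⟩ʳ q)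
    positive q≢ = n≢0⇒n>0 λ eq →
      q≢ (ʳ-injective π (toℕ-injective (trans eq (sym value-at-zeroPosition))))

    -- By induction, earlier positions hold the values that the swap assigns to them, and by
    -- injectivity none of these is `v`. A value missing at its due position thus occurs further
    -- right.
    position-later : ∀ i → (∀ q → q Fin.< i → SwapAt q) → BlockSwap j₀ ℓ₀ (toℕ i) v →
                     toℕ (π ⟨$⟩ʳ i) ≢ v → ∀ q → toℕ (π ⟨$⟩ʳ q) ≡ v → i Fin.< q
    position-later i ih s πi≢v q refl with <-cmp (toℕ q) (toℕ i)
    ... | tri> _ _ i<q = i<q
    ... | tri≈ _ q≡i _ = contradiction (cong (toℕ ∘ (π ⟨$⟩ʳ_)) (sym (toℕ-injective q≡i))) πi≢v
    ... | tri< q<i _ _ = contradiction (swap-injective (ih q q<i) s) (<⇒≢ q<i)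

    -- If the entry is too small, it forms 321 with its predecessor and the later 0. If it is too
    -- large, the due value, one more than the predecessor, comes later and completes a 132.
    swap-before-zero : ∀ i → (∀ q → q Fin.< suc i → SwapAt q) → toℕ (suc i) < ℓ₀ → SwapAt (suc i)
    swap-before-zero i ih si<ℓ = by-cases (<-cmp w (j₀ + suc (toℕ i)))
      where
      w = toℕ (π ⟨$⟩ʳ suc i)
      i⁻ = inject₁ i
      i⁻<si : i⁻ Fin.< suc i
      i⁻<si = s≤s (≤-reflexive (toℕ-inject₁ i))
      prev : toℕ (π ⟨$⟩ʳ i⁻) ≡ j₀ + toℕ i
      prev = trans (swap-functional (ih i⁻ i⁻<si) (up (<-trans i⁻<si si<ℓ) refl))
                   (cong (j₀ +_) (toℕ-inject₁ i))
      prev<v : toℕ (π ⟨$⟩ʳ i⁻) < j₀ + suc (toℕ i)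
      prev<v = ≤-reflexive (trans (cong suc prev) (sym (+-suc j₀ (toℕ i))))
      by-cases : Tri (w < j₀ + suc (toℕ i)) (w ≡ j₀ + suc (toℕ i)) (w > j₀ + suc (toℕ i)) →
                 SwapAt (suc i)
      by-cases (tri≈ _ eq _) = up si<ℓ eq
      by-cases (tri< w<v _ _) = ⊥-elim (av321 (contains-321 π i⁻<si si<ℓ
          (subst (_< w) (sym value-at-zeroPosition) (positive (<⇒≢ si<ℓ ∘ cong toℕ)))
          (≤∧≢⇒< w≤prev λ eq → <⇒≢ i⁻<si (cong toℕ (sym (ʳ-injective π (toℕ-injective eq)))))))
        where
        w≤prev : w ≤ toℕ (π ⟨$⟩ʳ i⁻)
        w≤prev = subst (w ≤_) (sym prev) (s≤s⁻¹ (subst (suc w ≤_) (+-suc j₀ (toℕ i)) w<v))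
      by-cases (tri> _ w≢v v<w) with position (<-trans v<w (toℕ<n (π ⟨$⟩ʳ suc i)))
      ... | q , πq≡v = ⊥-elim (av132 (contains-132 π i⁻<si
          (position-later (suc i) ih (up si<ℓ refl) w≢v q πq≡v)
          (subst (toℕ (π ⟨$⟩ʳ i⁻) <_) (sym πq≡v) prev<v) (subst (_< w) (sym πq≡v) v<w)))

    -- If `w < v`, let `i′` be the due position of `w`: `i′ < i` would repeat a value, and `i′ > i`
    -- would give the swap a descent starting outside its first block. If `w > v`, the entries 0,
    -- `w` and the later `v` form 132.
    swap-from-zero : ∀ i → (∀ q → q Fin.< i → SwapAt q) → ℓ₀ ≤ toℕ i → SwapAt i
    swap-from-zero i ih ℓ≤i with swap-total j₀ ℓ₀ (toℕ i)
    ... | v , s = by-cases (<-cmp w v)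
      where
      w = toℕ (π ⟨$⟩ʳ i)
      by-cases : Tri (w < v) (w ≡ v) (w > v) → SwapAt i
      by-cases (tri≈ _ eq _) = subst (BlockSwap j₀ ℓ₀ (toℕ i)) (sym eq) s
      by-cases (tri< w<v w≢v _) with swap-total ℓ₀ j₀ w
      ... | i′ , s′ with <-cmp i′ (toℕ i)
      ... | tri> _ _ i<i′ =
        contradiction (proj₁ (swap-descent s (swap-sym s′) i<i′ w<v)) (≤⇒≯ ℓ≤i)
      ... | tri≈ _ refl _ = contradiction (swap-functional (swap-sym s′) s) w≢v
      ... | tri< i′<i _ _ =
        contradiction (trans (cong toℕ (sym q≡i)) (toℕ-fromℕ< i′<n)) (<⇒≢ i′<i ∘ sym)
        where
        i′<n = <-trans i′<i (toℕ<n i)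
        q = fromℕ< i′<n
        q<i : q Fin.< i
        q<i = subst (_< toℕ i) (sym (toℕ-fromℕ< i′<n)) i′<i
        q≡i : q ≡ i
        q≡i = ʳ-injective π (toℕ-injective (swap-functional (ih q q<i)
          (subst (λ x → BlockSwap j₀ ℓ₀ x w) (sym (toℕ-fromℕ< i′<n)) (swap-sym s′))))
      by-cases (tri> _ w≢v v<w) with position (<-trans v<w (toℕ<n (π ⟨$⟩ʳ i)))
      ... | q , πq≡v = ⊥-elim (av132 (contains-132 π ℓ<i i<q
          (subst₂ _<_ (sym value-at-zeroPosition) refl
            (positive (<⇒≢ (<-trans ℓ<i i<q) ∘ cong toℕ ∘ sym)))
          (subst (_< w) (sym πq≡v) v<w)))
        where
        i<q = position-later i ih s w≢v q πq≡v
        -- The inequality is strict since the value at `zeroPosition` is 0 and cannot exceed `v`.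
        ℓ<i : zeroPosition Fin.< i
        ℓ<i = ≤∧≢⇒< ℓ≤i λ ℓ≡i → n≮0 (subst (v <_)
          (trans (cong (toℕ ∘ (π ⟨$⟩ʳ_)) (sym (toℕ-injective ℓ≡i))) value-at-zeroPosition) v<w)

    swap-at : ∀ i → Acc Fin._<_ i → SwapAt i
    swap-at i (acc rs) with toℕ i <? ℓ₀
    swap-at i (acc rs)       | no i≮ℓ  = swap-from-zero i (λ q q<i → swap-at q (rs q<i)) (≮⇒≥ i≮ℓ)
    swap-at zero _           | yes 0<ℓ = up 0<ℓ (sym (+-identityʳ j₀))
    swap-at (suc i) (acc rs) | yes i<ℓ = swap-before-zero i (λ q q<i → swap-at q (rs q<i)) i<ℓ

  avoider-isSwap : IsSwap (toℕ (π ⟨$⟩ʳ zero)) (toℕ (π ⟨$⟩ˡ zero)) π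
  avoider-isSwap i = swap-at i (<-wellFounded i)

-- Counting pairs of block lengths.

-- Pairs with x + y + 1 < N; the subtraction reduces both for x = 0 and for x a
-- successor, so that Pairs (suc N) splits definitionally into Fin N and Pairs N.
Pairs : ℕ → Set
Pairs N = Σ (Fin N) λ x → Fin (N ∸ suc (toℕ x))

Pairs-≡ : ∀ {N} {p q : Pairs N} → toℕ (proj₁ p) ≡ toℕ (proj₁ q) →
          toℕ (proj₂ p) ≡ toℕ (proj₂ q) → p ≡ q
Pairs-≡ eq₁ eq₂ with toℕ-injective eq₁
... | refl with toℕ-injective eq₂
... | refl = refl

Pairs-suc : ∀ {N} → Pairs (suc N) ↔ (Fin N ⊎ Pairs N)
Pairs-suc = mk↔ₛ′
  (λ { (zero , y) → inj₁ y ; (suc x , y) → inj₂ (x , y) })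
  (λ { (inj₁ y) → zero , y ; (inj₂ (x , y)) → suc x , y })
  (λ { (inj₁ y) → refl ; (inj₂ (x , y)) → refl })
  (λ { (zero , y) → refl ; (suc x , y) → refl })

-- Splitting off `x = 0` is Pascal's rule with `N C 1 = N`.
Pairs↔Fin : ∀ N → Pairs N ↔ Fin (N C 2)
Pairs↔Fin zero = mk↔ₛ′ (λ ()) (λ ()) (λ ()) (λ ())
Pairs↔Fin (suc N) = subst (λ c → Pairs (suc N) ↔ Fin c) pascal
  (↔-trans Pairs-suc (↔-trans (↔-refl ⊎-↔ Pairs↔Fin N) (↔-sym +↔⊎)))
  where
  pascal : N + N C 2 ≡ suc N C 2
  pascal = trans (cong (_+ N C 2) (sym (nC1≡n N))) (nCk+nC[k+1]≡[n+1]C[k+1] N 1)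

-- The shifts build in `ℓ ≥ 2` and `j ≥ 1`, the condition for a peak.
block₁ block₂ : ∀ {N} → Pairs N → ℕ
block₁ (x , _) = 2 + toℕ x
block₂ (_ , y) = suc (toℕ y)

blocks-fit : ∀ {N} (p : Pairs N) → block₁ p + block₂ p ≤ suc N
blocks-fit {N} (x , y) = s≤s (subst (_≤ N) (+-comm (block₂ (x , y)) (suc (toℕ x)))
  (m≤o∸n⇒m+n≤o (block₂ (x , y)) (toℕ<n x) (toℕ<n y)))

blocks-surjective : ∀ {N} x y → (2 + x) + suc y ≤ suc N →
                    ∃ λ (p : Pairs N) → block₁ p ≡ 2 + x × block₂ p ≡ suc y
blocks-surjective {N} x y (s≤s b) =
  (fromℕ< x<N , fromℕ< y<) , cong (2 +_) x≡ , cong suc (toℕ-fromℕ< y<)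
  where
  x<N = m+n≤o⇒m≤o (suc x) b
  x≡ = toℕ-fromℕ< x<N
  y< : y < N ∸ suc (toℕ (fromℕ< x<N))
  y< = subst (λ z → y < N ∸ suc z) (sym x≡)
    (m+n≤o⇒m≤o∸n (suc y) (subst (_≤ N) (+-comm (suc x) (suc y)) b))

-- Classification with unique parameters.

Classified : ∀ {N} → Permutation′ (suc N) → Set
Classified {N} π = (∃ λ (t : Fin (suc N)) → IsSwap (toℕ t) 1 π) ⊎
                   (∃ λ (p : Pairs N) → IsSwap (block₂ p) (block₁ p) π)

classify : ∀ {N} (π : Permutation′ (suc N)) → Avoids π132 π → Avoids π321 π → Classified π
classify {N} π av132 av321 =
  by-cases (toℕ (π ⟨$⟩ʳ zero)) (toℕ (π ⟨$⟩ˡ zero)) refl refl (avoider-isSwap π av132 av321)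
  where
  -- With `j = 0` every `ℓ` describes the identity; `ℓ = 1` is chosen as its representative.
  identity : ∀ {ℓ} → IsSwap 0 ℓ π → IsSwap 0 1 π
  identity isSwap i with swap-total 0 1 (toℕ i)
  ... | _ , s = subst (BlockSwap 0 1 (toℕ i))
    (trans (swap-trivial s) (sym (swap-trivial (isSwap i)))) s
  by-cases : ∀ j ℓ → toℕ (π ⟨$⟩ʳ zero) ≡ j → toℕ (π ⟨$⟩ˡ zero) ≡ ℓ → IsSwap j ℓ π → Classified π
  by-cases zero _ _ _ isSwap = inj₁ (zero , identity isSwap)
  by-cases (suc j) 0 π0≡j ℓ≡0 isSwap = contradiction (trans (sym π0≡j)
    (trans (cong (toℕ ∘ (π ⟨$⟩ʳ_)) (sym (toℕ-injective ℓ≡0))) (cong toℕ (inverseʳ π)))) λ ()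
  by-cases j@(suc _) 1 π0≡j _ isSwap =
    inj₁ (π ⟨$⟩ʳ zero , subst (λ j → IsSwap j 1 π) (sym π0≡j) isSwap)
  by-cases (suc j) (suc (suc x)) _ ℓ≡ isSwap with blocks-surjective {N} x j fits
    where
    1+x<n : suc x < suc N
    1+x<n = <-trans (n<1+n (suc x)) (subst (_< suc N) ℓ≡ (toℕ<n (π ⟨$⟩ˡ zero)))
    -- The last entry of the first block has value `j + ℓ - 1` for the block lengths `j` and `ℓ`,
    -- and this is less than `n`.
    fits : (2 + x) + suc j ≤ suc N
    fits = subst (_≤ suc N)
      (trans (cong suc (isSwap-value π isSwap 1+x<n (up ≤-refl refl)))
             (trans (sym (+-suc (suc j) (suc x))) (+-comm (suc j) (2 + x))))
      (toℕ<n (π ⟨$⟩ʳ fromℕ< 1+x<n))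
  ... | p , ℓ≡′ , j≡′ =
    inj₂ (p , subst₂ (λ j ℓ → IsSwap j ℓ π) (sym j≡′) (sym ℓ≡′) isSwap)

-- Counting avoiders by their peaks.

swapAvoider : ∀ {k} j ℓ (b : ℓ + j ≤ n) → pk (swapPerm j ℓ b) ≡ k → Avoider n k
swapAvoider j ℓ b pk≡k = swapPerm j ℓ b ,
  swap-avoids-132 (swapPerm j ℓ b) (swapPerm-isSwap j ℓ b) ,
  swap-avoids-321 (swapPerm j ℓ b) (swapPerm-isSwap j ℓ b) ,
  pk≡k

isSwap-unique : ∀ (π σ : Permutation′ n) → IsSwap j ℓ π → IsSwap j ℓ σ →
                ∀ i → π ⟨$⟩ʳ i ≡ σ ⟨$⟩ʳ i
isSwap-unique _ _ s t i = toℕ-injective (swap-functional (s i) (t i))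

isSwap-head : (π : Permutation′ (suc n)) → IsSwap j (suc ℓ) π → toℕ (π ⟨$⟩ʳ zero) ≡ j
isSwap-head π isSwap = trans (swap-functional (isSwap zero) (up z<s refl)) (+-identityʳ _)

-- The value 0 opens the second block, so its position is the length of the first. Together with
-- `isSwap-head`, this recovers both parameters.
isSwap-zeroPosition : (π : Permutation′ (suc n)) → IsSwap (suc j) ℓ π → toℕ (π ⟨$⟩ˡ zero) ≡ ℓ
isSwap-zeroPosition {j = j} {ℓ} π isSwap = trans
  (swap-functional
    (swap-sym (subst (BlockSwap (suc j) ℓ _) (cong toℕ (inverseʳ π)) (isSwap (π ⟨$⟩ˡ zero))))
    (up z<s refl))
  (+-identityʳ ℓ)

-- Avoiders are compared by their values alone, so injectivity and surjectivity of the
-- parametrisation are required only up to pointwise equality.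
cardinality : ∀ {A : Set} {c k} (f : A → Avoider n k) → A ↔ Fin c →
  (∀ {x y} → (∀ i → proj₁ (f x) ⟨$⟩ʳ i ≡ proj₁ (f y) ⟨$⟩ʳ i) → x ≡ y) →
  (∀ (σ : Avoider n k) → ∃ λ x → ∀ i → proj₁ (f x) ⟨$⟩ʳ i ≡ proj₁ σ ⟨$⟩ʳ i) →
  HasCardinality (Avoiders n k) c
cardinality {n} {A} {k = k} f A↔Fin injective surjective =
  inverse-trans (inverse-sym (Bijection⇒Inverse bijection)) A↔Fin
  where
  bijection : Bijection (setoid A) (Avoiders n k)
  bijection = record
    { to        = f
    ; cong      = λ { refl _ → refl }
    ; bijective = injective , λ σ → proj₁ (surjective σ) , λ { refl → proj₂ (surjective σ) }
    }

module _ {N : ℕ} where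

  peaklessPerm : Fin (suc N) → Permutation′ (suc N)
  peaklessPerm t = swapPerm (toℕ t) 1 (toℕ<n t)

  peakless-isSwap : ∀ t → IsSwap (toℕ t) 1 (peaklessPerm t)
  peakless-isSwap t = swapPerm-isSwap (toℕ t) 1 (toℕ<n t)

  peakless : Fin (suc N) → Avoider (suc N) 0
  peakless t = swapAvoider (toℕ t) 1 (toℕ<n t) (pk≡0 (peaklessPerm t) (peakless-isSwap t) ≤-refl)

  peakedPerm : Pairs N → Permutation′ (suc N)
  peakedPerm p = swapPerm (block₂ p) (block₁ p) (blocks-fit p)

  peaked-isSwap : ∀ p → IsSwap (block₂ p) (block₁ p) (peakedPerm p)
  peaked-isSwap p = swapPerm-isSwap (block₂ p) (block₁ p) (blocks-fit p)

  peaked : Pairs N → Avoider (suc N) 1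
  peaked p = swapAvoider (block₂ p) (block₁ p) (blocks-fit p)
    (pk≡1 (peakedPerm p) (peaked-isSwap p) (blocks-fit p))

  peakless-cardinality : HasCardinality (Avoiders (suc N) 0) (suc N)
  peakless-cardinality = cardinality peakless ↔-refl injective surjective
    where
    injective : ∀ {t u} → (∀ i → peaklessPerm t ⟨$⟩ʳ i ≡ peaklessPerm u ⟨$⟩ʳ i) → t ≡ u
    injective {t} {u} eq = toℕ-injective (trans (sym (value t)) (trans (cong toℕ (eq zero)) (value u)))
      where
      value : ∀ t → toℕ (peaklessPerm t ⟨$⟩ʳ zero) ≡ toℕ t
      value t = isSwap-head (peaklessPerm t) (peakless-isSwap t)
    surjective : ∀ σ → ∃ λ t → ∀ i → peaklessPerm t ⟨$⟩ʳ i ≡ proj₁ σ ⟨$⟩ʳ i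
    surjective (π , av132 , av321 , pk≡) with classify π av132 av321
    ... | inj₁ (t , isSwap) = t , isSwap-unique (peaklessPerm t) π (peakless-isSwap t) isSwap
    ... | inj₂ (p , isSwap) = contradiction (trans (sym pk≡) (pk≡1 π isSwap (blocks-fit p))) λ ()

  peaked-cardinality : HasCardinality (Avoiders (suc N) 1) (N C 2)
  peaked-cardinality = cardinality peaked (Pairs↔Fin N) injective surjective
    where
    injective : ∀ {p q} → (∀ i → peakedPerm p ⟨$⟩ʳ i ≡ peakedPerm q ⟨$⟩ʳ i) → p ≡ q
    injective {p} {q} eq = Pairs-≡
      (suc-injective (suc-injective (trans (sym (isSwap-zeroPosition π (peaked-isSwap p)))
        (isSwap-zeroPosition π isSwap-q))))
      (suc-injective (trans (sym (isSwap-head π (peaked-isSwap p)))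
        (isSwap-head π isSwap-q)))
      where
      π = peakedPerm p
      -- Both parameter pairs now describe the same `π`, so its position of 0 can be read off twice
      -- without comparing the inverses of two permutations.
      isSwap-q : IsSwap (block₂ q) (block₁ q) π
      isSwap-q i = subst (BlockSwap _ _ (toℕ i)) (cong toℕ (sym (eq i))) (peaked-isSwap q i)
    surjective : ∀ σ → ∃ λ p → ∀ i → peakedPerm p ⟨$⟩ʳ i ≡ proj₁ σ ⟨$⟩ʳ i
    surjective (π , av132 , av321 , pk≡) with classify π av132 av321
    ... | inj₁ (t , isSwap) = contradiction (trans (sym pk≡) (pk≡0 π isSwap ≤-refl)) λ ()
    ... | inj₂ (p , isSwap) = p , isSwap-unique (peakedPerm p) π (peaked-isSwap p) isSwap

  no-more-peaks : ∀ {k} → ¬ Avoider (suc N) (2 + k)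
  no-more-peaks (π , av132 , av321 , pk≡) with classify π av132 av321
  ... | inj₁ (t , isSwap) = contradiction (trans (sym pk≡) (pk≡0 π isSwap ≤-refl)) λ ()
  ... | inj₂ (p , isSwap) = contradiction (trans (sym pk≡) (pk≡1 π isSwap (blocks-fit p))) λ ()

proposition24 : ∀ (n k : ℕ) → 1 ≤ n → HasCardinality (Avoiders n k) (closedForm n k)
proposition24 (suc N) 0 _ = peakless-cardinality
proposition24 (suc N) 1 _ = peaked-cardinality
proposition24 (suc N) (suc (suc k)) _ =
  cardinality (λ ()) ↔-refl (λ { {()} }) (λ σ → contradiction σ no-more-peaks)
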